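{- Let $b\ge 2$ and let $N$ be a $b$-wARH number with $k$ base-$b$ digits and with additive extra term $A$. Then $k\le A+4$.
   Context: Fix a base $b\ge 2$. $s_b(N)$ is the sum of the base-$b$ digits of $N$. For a positive integer $X$, its reversal $X^R$ is the integer whose base-$b$ representation is that of $X$ written in reverse order (leading zeros of the result are dropped). A positive integer $N$ is a $b$-wARH number if there exists an integer $A\ge 0$, called an additive extra term of $N$, such that $N=(A+s_b(N))+(A+s_b(N))^R$. -}

module Defs where

open import Data.Digit using (Expansion; fromDigits; toDigits)
open import Data.Fin using (toℕ)
open import Data.List using (length; map; reverse)
open import Data.Nat using (ℕ; _+_; _≤_; _<_; _≤?_)
open import Data.Nat.ListAction using (sum)
open import Data.Product using (∃; _×_; proj₁)
open import Relation.Binary.PropositionalEquality using (_≡_)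
open import Relation.Nullary.Decidable using (fromWitness)

module _ (b : ℕ) (b≥2 : 2 ≤ b) where

  -- The base-b digits of n, least significant first, without superfluous
  -- zeros at the most significant end (the expansion of 0 is 0 ∷ []).
  digits : ℕ → Expansion b
  digits n = proj₁ (toDigits b {fromWitness b≥2} n)

  numDigits : ℕ → ℕ
  numDigits n = length (digits n)

  digitSum : ℕ → ℕ
  digitSum n = sum (map toℕ (digits n))

  -- Passing through the value discards the leading zeros of the reversed
  -- expansion.
  reversal : ℕ → ℕ
  reversal n = fromDigits (reverse (digits n))

  IsAdditiveExtraTerm : ℕ → ℕ → Set
  IsAdditiveExtraTerm N A =
    N ≡ (A + digitSum N) + reversal (A + digitSum N)

  IsWARH : ℕ → Set
  IsWARH N = 0 < N × ∃ λ A → IsAdditiveExtraTerm N A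

{-# OPTIONS --safe #-}

-- Write c = b - 1 and suppose N has 5 + j digits but A ≤ j.  As s(N) ≤ (5 + j) c,
-- the number M = A + s(N) is at most j + (5 + j) c < b ^ (3 + j).  Hence M and
-- its reversal are both below b ^ (3 + j), so their sum N is below
-- 2 b ^ (3 + j) ≤ b ^ (4 + j) and has at most 4 + j digits, a contradiction.

module Submission where

open import Defs
open import Data.Digit using (Expansion; fromDigits; toDigits)
open import Data.Fin using (Fin; toℕ; zero; suc)
open import Data.Fin.Properties using (toℕ<n; toℕ≤pred[n])
open import Data.List using (length; map; reverse; []; _∷_)
open import Data.List.Properties using (length-reverse)
open import Data.Nat
  using (ℕ; zero; suc; _+_; _*_; _^_; _∸_; _≤_; _<_; _<′_; z≤n; s≤s; z<s; 2+)
open import Data.Nat.DivMod using (_divMod_; result)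
open import Data.Nat.Induction
  using (<′-Rec; <′-wellFounded′; Acc; acc)
open import Data.Nat.ListAction using (sum)
open import Data.Nat.Properties
open import Data.Nat.Tactic.RingSolver using (solve-∀)
open import Data.Product using (∃; proj₁; _,_)
open import Induction.WellFounded using (module Some)
open import Relation.Binary.PropositionalEquality
  using (_≡_; refl; sym; cong; subst)

open ≤-Reasoning

ExpansionOf : ℕ → ℕ → Set
ExpansionOf b n = ∃ λ (ds : Expansion b) → fromDigits ds ≡ n

-- A record rather than a function of e, so that unification can read off e.
record MinimalLength (b n : ℕ) (e : ExpansionOf b n) : Set where
  constructor minimalLength
  field length≤ : ∀ l → n < b ^ suc l → length (proj₁ e) ≤ suc l

open MinimalLength

-- As `suc q * b` is at most the whole number, cancelling one factor `b` puts `suc q` below `b ^ l`: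
-- the digit `r` costs exactly one in the exponent.
length-∷≤ : ∀ {b q m} r → (∀ l → suc q < b ^ suc l → m ≤ suc l) →
  ∀ l → r + suc q * b < b ^ suc l → suc m ≤ suc l
length-∷≤ {b} {q} r m≤ l n<b^l = go l (*-cancelˡ-< b (suc q) (b ^ l) (begin-strict
    b * suc q      ≡⟨ *-comm b (suc q) ⟩
    suc q * b      ≤⟨ m≤n+m (suc q * b) r ⟩
    r + suc q * b  <⟨ n<b^l ⟩
    b ^ suc l      ∎))
  where
  go : ∀ l → suc q < b ^ l → suc _ ≤ suc l
  -- The quotient is positive, so it cannot lie below `b ^ 0`.
  go zero    (s≤s ())
  go (suc l) q<b^l = s≤s (m≤ l q<b^l)

-- By induction on the accessibility proof, along which the builder unfolds: an invariant kept by
-- one step `f` passes to every value the recursion produces.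
wfRecBuilder-elim : {P : ℕ → Set} {f : ∀ n → <′-Rec P n → P n} (Q : ∀ n → P n → Set) →
  (∀ n (ih : <′-Rec P n) → (∀ {m} (m<n : m <′ n) → Q m (ih m<n)) → Q n (f n ih)) →
  ∀ n {m o} (m<n : m <′ n) {o<m : o <′ m} →
  Q o (Some.wfRecBuilder P f m (<′-wellFounded′ n m<n) o<m)
wfRecBuilder-elim {P} {f} Q step n m<n = go (<′-wellFounded′ n m<n) _
  where
  go : ∀ {m o} (a : Acc _<′_ m) (o<m : o <′ m) → Q o (Some.wfRecBuilder P f m a o<m)
  go (acc rs) o<m = step _ _ (go (rs o<m))

-- The proof must begin as the one inside toDigits does: it occurs in the
-- normal form of toDigits, and unification has to recognise it there.
quotient<′ : ∀ x k r → 2 + x + (r + (x + (1 + x) * k)) ≡ r + (1 + x) * (2 + k) →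
  1 + x <′ r + (1 + x) * (2 + k)
quotient<′ x k r eq = ≤⇒≤′ (begin
  2 + x                          ≤⟨ m≤m+n _ _ ⟩
  2 + x + (x + (1 + x) * k + r)  ≡⟨ cong (2 + x +_) (+-comm _ r) ⟩
  equals eq)

-- The recursion step of toDigits is local to toDigits and has no name here.  It
-- becomes visible to unification after two divisions with nonzero quotient,
-- which solves the underscores in the types of step₀ and step₁.  The second
-- remainder has to be split so that n, on which the local function also
-- depends, is computed from pattern variables; hence the two variants.
mutual
  step₀ : ∀ k (r : Fin (2+ k)) (q m : ℕ) (ih : <′-Rec (ExpansionOf (2+ k)) m) →
    (∀ {i} (i<m : i <′ m) → MinimalLength (2+ k) i (ih i<m)) → MinimalLength (2+ k) m _

  step₁ : ∀ k (r : Fin (2+ k)) (s : Fin (1 + k)) (q m : ℕ) (ih : <′-Rec (ExpansionOf (2+ k)) m) →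
    (∀ {i} (i<m : i <′ m) → MinimalLength (2+ k) i (ih i<m)) → MinimalLength (2+ k) m _

  toDigits-minimalLength : ∀ k n → MinimalLength (2+ k) n (toDigits (2+ k) n)
  toDigits-minimalLength k n with n divMod 2+ k
  ... | result zero r eq = minimalLength λ _ _ → s≤s z≤n
  ... | result (suc q) r refl with suc q divMod 2+ k
  ... | result zero s eq = minimalLength (length-∷≤ {q = q} (toℕ r) λ _ _ → s≤s z≤n)
  ... | result (suc p) zero refl = minimalLength (length-∷≤ (toℕ r) (length-∷≤ 0 (length≤
          (wfRecBuilder-elim (MinimalLength (2+ k)) (step₀ k r p)
            (toℕ r + (suc p * 2+ k) * 2+ k)
            (quotient<′ (1 + (k + p * 2+ k)) k (toℕ r) _)))))
  ... | result (suc p) (suc s) refl = minimalLength (length-∷≤ (toℕ r) (length-∷≤ (toℕ (suc s)) (length≤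
          (wfRecBuilder-elim (MinimalLength (2+ k)) (step₁ k r s p)
            (toℕ r + (toℕ (suc s) + suc p * 2+ k) * 2+ k)
            (quotient<′ (toℕ s + suc p * 2+ k) k (toℕ r) _)))))

  step₀ k _ _ m ih h with m divMod 2+ k
  ... | result zero    r eq   = minimalLength λ _ _ → s≤s z≤n
  ... | result (suc q) r refl = minimalLength (length-∷≤ (toℕ r) (length≤ (h _)))

  step₁ k _ _ _ m ih h with m divMod 2+ k
  ... | result zero    r eq   = minimalLength λ _ _ → s≤s z≤n
  ... | result (suc q) r refl = minimalLength (length-∷≤ (toℕ r) (length≤ (h _)))

length-toDigits : ∀ k n l → n < 2+ k ^ suc l → length (proj₁ (toDigits (2+ k) n)) ≤ suc l
length-toDigits k n = length≤ (toDigits-minimalLength k n)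

-- Leading zeros are allowed, so the bound also covers a reversed expansion.
fromDigits<b^length : ∀ {b} (ds : Expansion b) → fromDigits ds < b ^ length ds
fromDigits<b^length     []       = z<s
fromDigits<b^length {b} (d ∷ ds) = begin-strict
  toℕ d + fromDigits ds * b  <⟨ +-monoˡ-< _ (toℕ<n d) ⟩
  suc (fromDigits ds) * b    ≤⟨ *-monoˡ-≤ b (fromDigits<b^length ds) ⟩
  b ^ length ds * b          ≡⟨ *-comm _ b ⟩
  b ^ length (d ∷ ds)        ∎

sum-digits≤ : ∀ {c} (ds : Expansion (suc c)) → sum (map toℕ ds) ≤ length ds * c
sum-digits≤ []       = z≤n
sum-digits≤ (d ∷ ds) = +-mono-≤ (toℕ≤pred[n] d) (sum-digits≤ ds)

module _ (k : ℕ) (b≥2 : 2 ≤ 2+ k) where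

  private b = 2+ k

  reversal< : ∀ n l → n < b ^ suc l → reversal b b≥2 n < b ^ suc l
  reversal< n l n<b^l = begin-strict
    reversal b b≥2 n         <⟨ fromDigits<b^length (reverse ds) ⟩
    b ^ length (reverse ds)  ≡⟨ cong (b ^_) (length-reverse ds) ⟩
    b ^ length ds            ≤⟨ ^-monoʳ-≤ b (length-toDigits k n l n<b^l) ⟩
    b ^ suc l                ∎
    where ds = digits b b≥2 n

  numDigits-+-reversal : ∀ n l → n < b ^ suc l →
    numDigits b b≥2 (n + reversal b b≥2 n) ≤ 2+ l
  numDigits-+-reversal n l n<b^l = length-toDigits k _ (suc l) (begin-strict
    n + reversal b b≥2 n   <⟨ +-mono-< n<b^l (reversal< n l n<b^l) ⟩
    b ^ suc l + b ^ suc l  ≡⟨ cong (b ^ suc l +_) (+-identityʳ _) ⟨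
    2 * b ^ suc l          ≤⟨ *-monoˡ-≤ (b ^ suc l) b≥2 ⟩
    b ^ 2+ l               ∎)

-- Induction on `j`: each step at most doubles the left side and multiplies the right side by
-- `2+ d`, which is at least 2.
j+[5+j]c<[1+c]^[3+j] : ∀ d j → j + (5 + j) * suc d < 2+ d ^ (3 + j)
j+[5+j]c<[1+c]^[3+j] d zero = begin
  suc (5 * suc d)                                ≤⟨ m≤m+n _ _ ⟩
  -- The second summand is `(2 + d) ^ 3` minus the first, in Horner form; its coefficients are all
  -- positive.
  suc (5 * suc d) + (2 + d * (7 + d * (6 + d)))  ≡⟨ eq d ⟩
  2+ d ^ 3                                       ∎
  where
  eq : ∀ d → suc (5 * suc d) + (2 + d * (7 + d * (6 + d))) ≡ (2 + d) * ((2 + d) * ((2 + d) * 1))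
  eq = solve-∀
j+[5+j]c<[1+c]^[3+j] d (suc j) = begin
  suc (suc j + (6 + j) * suc d)        ≤⟨ m≤m+n _ _ ⟩
  -- The added term is what the new left side lacks to reach twice the old one.
  suc (suc j + (6 + j) * suc d) + (j + (4 + j) * suc d)  ≡⟨ eq d j ⟩
  2 * suc (j + (5 + j) * suc d)        ≤⟨ *-mono-≤ (s≤s (s≤s (z≤n {d}))) (j+[5+j]c<[1+c]^[3+j] d j) ⟩
  2+ d ^ (4 + j)                       ∎
  where
  eq : ∀ d j → suc (suc j + (6 + j) * suc d) + (j + (4 + j) * suc d) ≡ 2 * suc (j + (5 + j) * suc d)
  eq = solve-∀

mainTheorem17 : (b : ℕ) (b≥2 : 2 ≤ b) (N k A : ℕ) →
    IsWARH b b≥2 N →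
    numDigits b b≥2 N ≡ k →
    IsAdditiveExtraTerm b b≥2 N A →
    k ≤ A + 4
mainTheorem17 b@(2+ d) b≥2@(s≤s (s≤s _)) N k A _ refl N≡M+Mᴿ = ≮⇒≥ λ A+4<k →
  let
    -- The subtraction does not truncate, since `A + 4 < k` forces `5 ≤ k`.
    j = k ∸ 5
    M = A + digitSum b b≥2 N
    5+A≤k : 5 + A ≤ k
    5+A≤k = subst (_< k) (+-comm A 4) A+4<k
    k≡5+j : k ≡ 5 + j
    k≡5+j = sym (m+[n∸m]≡n (≤-trans (m≤m+n 5 A) 5+A≤k))
    A≤j : A ≤ j
    A≤j = +-cancelˡ-≤ 5 A j (subst (5 + A ≤_) k≡5+j 5+A≤k)
    M<b^[3+j] : M < b ^ (3 + j)
    M<b^[3+j] = begin-strict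
      M                    ≤⟨ +-mono-≤ A≤j (sum-digits≤ (digits b b≥2 N)) ⟩
      j + k * suc d        ≡⟨ cong (λ k → j + k * suc d) k≡5+j ⟩
      j + (5 + j) * suc d  <⟨ j+[5+j]c<[1+c]^[3+j] d j ⟩
      b ^ (3 + j)          ∎
  in <-irrefl refl (begin-strict
    k                                        ≡⟨ cong (numDigits b b≥2) N≡M+Mᴿ ⟩
    numDigits b b≥2 (M + reversal b b≥2 M)   ≤⟨ numDigits-+-reversal d b≥2 M (2 + j) M<b^[3+j] ⟩
    4 + j                                    <⟨ n<1+n _ ⟩
    5 + j                                    ≡⟨ k≡5+j ⟨
    k                                        ∎)
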